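{- If $G$ is an oriented tree on $n\ge 2$ vertices with non-zero edge weights in $\mathbb{C}\setminus\mathbb{R}^-$ and complex signless incidence matrix $N$, then $\operatorname{rank}(N)=n-1$.
   Context: An oriented tree is a directed graph obtained from a finite undirected tree by giving each edge exactly one direction. Each directed edge $(u,v)$ (from $u$ to $v$) has a non-zero complex weight $w_{uv}$; $\mathbb{R}^-$ denotes the negative real numbers and $\sqrt{\cdot}$ is the principal square root. The complex signless incidence matrix of $G$ (with edges $e_1,\dots,e_{n-1}$) is the $n\times(n-1)$ matrix $N=(n_{ij})$ where, for $e_j=(u,v)$, $n_{ij}=\sqrt{w_{uv}}$ if $i=u$, $n_{ij}=\sqrt{\overline{w_{uv}}}$ if $i=v$, and $n_{ij}=0$ otherwise. -}

module Defs where

open import Level using (0ℓ)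
open import Algebra.Bundles.Raw using (RawRing)
open import Data.Fin.Base using (Fin)
open import Data.List.Base using ([]; _∷_; _++_; length)
open import Data.List.Relation.Unary.Linked using (Linked)
open import Data.List.Relation.Unary.Unique.Propositional using (Unique)
open import Data.Nat.Base as ℕ using (ℕ; _∸_)
import Data.Nat.Properties as ℕ
open import Data.Product.Base using (_×_; _,_; ∃-syntax; uncurry)
open import Data.Rational.Base as ℚ using (ℚ; 0ℚ; 1ℚ)
import Data.Rational.Properties as ℚ
open import Data.Rational.Solver using (module +-*-Solver)
open import Data.Sum.Base using (_⊎_)
open import Data.Vec.Functional using (Vector)
import Algebra.Definitions.RawMonoid as RawMonoidDefinitions
open import Function.Definitions using (Injective)
open import Relation.Binary.Core using (Rel)
open import Relation.Binary.Construct.Closure.ReflexiveTransitive using (Star)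
open import Relation.Binary.Definitions using (Symmetric; Asymmetric; Irreflexive)
open import Relation.Binary.PropositionalEquality
  using (_≡_; _≢_; refl; sym; trans; cong; cong₂; subst)
open import Relation.Nullary.Negation using (¬_)

------------------------------------------------------------------------
-- Real numbers: Cauchy sequences of rationals, up to the setoid equality _≈ᴿ_

IsCauchy : (ℕ → ℚ) → Set
IsCauchy x = ∀ ε → 0ℚ ℚ.< ε →
  ∃[ k ] (∀ m n → k ℕ.≤ m → k ℕ.≤ n → ℚ.∣ x m ℚ.- x n ∣ ℚ.< ε)

record ℝ : Set where
  constructor mkℝ
  field
    seq    : ℕ → ℚ
    cauchy : IsCauchy seq

open ℝ public

infix 4 _≈ᴿ_ _<ᴿ_ _≤ᴿ_

_≈ᴿ_ : Rel ℝ 0ℓ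
x ≈ᴿ y = ∀ ε → 0ℚ ℚ.< ε → ∃[ k ] (∀ n → k ℕ.≤ n → ℚ.∣ seq x n ℚ.- seq y n ∣ ℚ.< ε)

_<ᴿ_ : Rel ℝ 0ℓ
x <ᴿ y = ∃[ ε ] (0ℚ ℚ.< ε × ∃[ k ] (∀ n → k ℕ.≤ n → seq x n ℚ.+ ε ℚ.≤ seq y n))

_≤ᴿ_ : Rel ℝ 0ℓ
x ≤ᴿ y = ¬ (y <ᴿ x)

private
  open ℚ.≤-Reasoning
  open +-*-Solver using (solve; _:=_; _:+_; _:*_; _:-_; :-_; con)

  const-cauchy : ∀ q → IsCauchy (λ _ → q)
  const-cauchy q ε 0<ε = 0 , λ _ _ _ _ →
    subst (ℚ._< ε) (sym (cong ℚ.∣_∣ (ℚ.+-inverseʳ q))) 0<ε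

  neg-cauchy : ∀ {x} → IsCauchy x → IsCauchy (λ n → ℚ.- x n)
  neg-cauchy {x} cx ε 0<ε = let k , h = cx ε 0<ε in k , λ m n k≤m k≤n →
    subst (ℚ._< ε)
      (sym (trans
        (cong ℚ.∣_∣ (solve 2 (λ a b → (:- a) :- (:- b) := :- (a :- b)) refl (x m) (x n)))
        (ℚ.∣-p∣≡∣p∣ (x m ℚ.- x n))))
      (h m n k≤m k≤n)

  +-cauchy : ∀ {x y} → IsCauchy x → IsCauchy y → IsCauchy (λ n → x n ℚ.+ y n)
  +-cauchy {x} {y} cx cy ε 0<ε =
    let
      0<ε/2 = subst (ℚ._< ℚ.½ ℚ.* ε) (ℚ.*-zeroʳ ℚ.½) (ℚ.*-monoʳ-<-pos ℚ.½ 0<ε)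
      k , h = cx (ℚ.½ ℚ.* ε) 0<ε/2
      l , g = cy (ℚ.½ ℚ.* ε) 0<ε/2
    in k ℕ.⊔ l , λ m n p q → begin-strict
      ℚ.∣ (x m ℚ.+ y m) ℚ.- (x n ℚ.+ y n) ∣
        ≡⟨ cong ℚ.∣_∣ (solve 4 (λ a b c d → (a :+ b) :- (c :+ d) := (a :- c) :+ (b :- d))
             refl (x m) (y m) (x n) (y n)) ⟩
      ℚ.∣ (x m ℚ.- x n) ℚ.+ (y m ℚ.- y n) ∣
        ≤⟨ ℚ.∣p+q∣≤∣p∣+∣q∣ (x m ℚ.- x n) (y m ℚ.- y n) ⟩
      ℚ.∣ x m ℚ.- x n ∣ ℚ.+ ℚ.∣ y m ℚ.- y n ∣
        <⟨ ℚ.+-mono-<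
             (h m n (ℕ.≤-trans (ℕ.m≤m⊔n k l) p) (ℕ.≤-trans (ℕ.m≤m⊔n k l) q))
             (g m n (ℕ.≤-trans (ℕ.m≤n⊔m k l) p) (ℕ.≤-trans (ℕ.m≤n⊔m k l) q)) ⟩
      ℚ.½ ℚ.* ε ℚ.+ ℚ.½ ℚ.* ε
        ≡⟨ solve 1 (λ e → con ℚ.½ :* e :+ con ℚ.½ :* e := e) refl ε ⟩
      ε ∎

  0<1 : 0ℚ ℚ.< 1ℚ
  0<1 = ℚ.positive⁻¹ 1ℚ

  bounded : ∀ {x} → IsCauchy x →
    ∃[ b ] (0ℚ ℚ.< b × ∃[ k ] (∀ n → k ℕ.≤ n → ℚ.∣ x n ∣ ℚ.≤ b))
  bounded {x} cx =
    let
      k , h = cx 1ℚ 0<1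
    in 1ℚ ℚ.+ ℚ.∣ x k ∣
     , subst (ℚ._< 1ℚ ℚ.+ ℚ.∣ x k ∣) (ℚ.+-identityʳ 0ℚ) (ℚ.+-mono-<-≤ 0<1 (ℚ.0≤∣p∣ (x k)))
     , k , λ n k≤n → begin
      ℚ.∣ x n ∣
        ≡⟨ cong ℚ.∣_∣ (solve 2 (λ a b → a := (a :- b) :+ b) refl (x n) (x k)) ⟩
      ℚ.∣ (x n ℚ.- x k) ℚ.+ x k ∣
        ≤⟨ ℚ.∣p+q∣≤∣p∣+∣q∣ (x n ℚ.- x k) (x k) ⟩
      ℚ.∣ x n ℚ.- x k ∣ ℚ.+ ℚ.∣ x k ∣
        ≤⟨ ℚ.+-monoˡ-≤ ℚ.∣ x k ∣ (ℚ.<⇒≤ (h n k k≤n ℕ.≤-refl)) ⟩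
      1ℚ ℚ.+ ℚ.∣ x k ∣ ∎

  *-bound : ∀ {a b p δ} → 0ℚ ℚ.< a → p ℚ.≤ a → 0ℚ ℚ.≤ b → b ℚ.< δ → p ℚ.* b ℚ.< a ℚ.* δ
  *-bound {a} {b} {p} {δ} 0<a p≤a 0≤b b<δ = begin-strict
    p ℚ.* b  ≤⟨ ℚ.*-monoʳ-≤-nonNeg b {{ℚ.nonNegative 0≤b}} p≤a ⟩
    a ℚ.* b  <⟨ ℚ.*-monoʳ-<-pos a {{ℚ.positive 0<a}} b<δ ⟩
    a ℚ.* δ  ∎

  *-close : ∀ {a b δ} s t u v → 0ℚ ℚ.< a → 0ℚ ℚ.< b → ℚ.∣ s ∣ ℚ.≤ a → ℚ.∣ v ∣ ℚ.≤ b →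
    ℚ.∣ s ℚ.- u ∣ ℚ.< δ → ℚ.∣ t ℚ.- v ∣ ℚ.< δ →
    ℚ.∣ s ℚ.* t ℚ.- u ℚ.* v ∣ ℚ.< (a ℚ.+ b) ℚ.* δ
  *-close {a} {b} {δ} s t u v 0<a 0<b s≤a v≤b s-u<δ t-v<δ = begin-strict
    ℚ.∣ s ℚ.* t ℚ.- u ℚ.* v ∣
      ≡⟨ cong ℚ.∣_∣ (solve 4 (λ s t u v → s :* t :- u :* v := s :* (t :- v) :+ v :* (s :- u))
           refl s t u v) ⟩
    ℚ.∣ s ℚ.* (t ℚ.- v) ℚ.+ v ℚ.* (s ℚ.- u) ∣
      ≤⟨ ℚ.∣p+q∣≤∣p∣+∣q∣ (s ℚ.* (t ℚ.- v)) (v ℚ.* (s ℚ.- u)) ⟩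
    ℚ.∣ s ℚ.* (t ℚ.- v) ∣ ℚ.+ ℚ.∣ v ℚ.* (s ℚ.- u) ∣
      ≡⟨ cong₂ ℚ._+_ (ℚ.∣p*q∣≡∣p∣*∣q∣ s (t ℚ.- v)) (ℚ.∣p*q∣≡∣p∣*∣q∣ v (s ℚ.- u)) ⟩
    ℚ.∣ s ∣ ℚ.* ℚ.∣ t ℚ.- v ∣ ℚ.+ ℚ.∣ v ∣ ℚ.* ℚ.∣ s ℚ.- u ∣
      <⟨ ℚ.+-mono-< (*-bound 0<a s≤a (ℚ.0≤∣p∣ (t ℚ.- v)) t-v<δ)
                    (*-bound 0<b v≤b (ℚ.0≤∣p∣ (s ℚ.- u)) s-u<δ) ⟩
    a ℚ.* δ ℚ.+ b ℚ.* δ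
      ≡⟨ ℚ.*-distribʳ-+ δ a b ⟨
    (a ℚ.+ b) ℚ.* δ ∎

  shrink : ∀ c ε → 0ℚ ℚ.< c → 0ℚ ℚ.< ε → ∃[ δ ] (0ℚ ℚ.< δ × c ℚ.* δ ≡ ε)
  shrink c ε 0<c 0<ε = r ℚ.* ε
    , subst (ℚ._< r ℚ.* ε) (ℚ.*-zeroʳ r) (ℚ.*-monoʳ-<-pos r 0<ε)
    , trans (sym (ℚ.*-assoc c r ε))
        (trans (cong (ℚ._* ε) (ℚ.*-inverseʳ c)) (ℚ.*-identityˡ ε))
    where
      instance
        c⁺ : ℚ.Positive c
        c⁺ = ℚ.positive 0<c
        c≢0 : ℚ.NonZero c
        c≢0 = ℚ.pos⇒nonZero c
      r : ℚ
      r = ℚ.1/ c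
      instance
        r⁺ : ℚ.Positive r
        r⁺ = ℚ.1/pos⇒pos c

  pos+pos : ∀ {a b} → 0ℚ ℚ.< a → 0ℚ ℚ.< b → 0ℚ ℚ.< a ℚ.+ b
  pos+pos {a} {b} 0<a 0<b = subst (ℚ._< a ℚ.+ b) (ℚ.+-identityʳ 0ℚ) (ℚ.+-mono-< 0<a 0<b)

  EventuallyBounded EventuallyWithin : (ℕ → ℚ) → ℚ → ℕ → Set
  EventuallyBounded x b k = ∀ n → k ℕ.≤ n → ℚ.∣ x n ∣ ℚ.≤ b
  EventuallyWithin  x ε k = ∀ m n → k ℕ.≤ m → k ℕ.≤ n → ℚ.∣ x m ℚ.- x n ∣ ℚ.< ε

  *-within : ∀ x y {a b δ ε} k₁ k₂ k₃ k₄ → 0ℚ ℚ.< a → 0ℚ ℚ.< b → (a ℚ.+ b) ℚ.* δ ≡ ε →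
    EventuallyBounded x a k₁ → EventuallyBounded y b k₂ →
    EventuallyWithin x δ k₃ → EventuallyWithin y δ k₄ →
    EventuallyWithin (λ n → x n ℚ.* y n) ε ((k₁ ℕ.⊔ k₂) ℕ.⊔ (k₃ ℕ.⊔ k₄))
  *-within x y k₁ k₂ k₃ k₄ 0<a 0<b eq x≤a y≤b h g m n k≤m k≤n =
    subst (ℚ.∣ x m ℚ.* y m ℚ.- x n ℚ.* y n ∣ ℚ.<_) eq
      (*-close (x m) (y m) (x n) (y n) 0<a 0<b
        (x≤a m (ℕ.m⊔n≤o⇒m≤o k₁ k₂ (left k≤m)))
        (y≤b n (ℕ.m⊔n≤o⇒n≤o k₁ k₂ (left k≤n)))
        (h m n (ℕ.m⊔n≤o⇒m≤o k₃ k₄ (right k≤m)) (ℕ.m⊔n≤o⇒m≤o k₃ k₄ (right k≤n)))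
        (g m n (ℕ.m⊔n≤o⇒n≤o k₃ k₄ (right k≤m)) (ℕ.m⊔n≤o⇒n≤o k₃ k₄ (right k≤n))))
    where
      left : ∀ {i} → (k₁ ℕ.⊔ k₂) ℕ.⊔ (k₃ ℕ.⊔ k₄) ℕ.≤ i → k₁ ℕ.⊔ k₂ ℕ.≤ i
      left = ℕ.m⊔n≤o⇒m≤o (k₁ ℕ.⊔ k₂) (k₃ ℕ.⊔ k₄)
      right : ∀ {i} → (k₁ ℕ.⊔ k₂) ℕ.⊔ (k₃ ℕ.⊔ k₄) ℕ.≤ i → k₃ ℕ.⊔ k₄ ℕ.≤ i
      right = ℕ.m⊔n≤o⇒n≤o (k₁ ℕ.⊔ k₂) (k₃ ℕ.⊔ k₄)

  *-cauchy : ∀ {x y} → IsCauchy x → IsCauchy y → IsCauchy (λ n → x n ℚ.* y n)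
  *-cauchy {x} {y} cx cy ε 0<ε =
    let
      a , 0<a , k₁ , x≤a = bounded {x} cx
      b , 0<b , k₂ , y≤b = bounded {y} cy
      δ , 0<δ , eq       = shrink (a ℚ.+ b) ε (pos+pos {a} {b} 0<a 0<b) 0<ε
      k₃ , h             = cx δ 0<δ
      k₄ , g             = cy δ 0<δ
    in (k₁ ℕ.⊔ k₂) ℕ.⊔ (k₃ ℕ.⊔ k₄)
     , *-within x y {a} {b} {δ} {ε} k₁ k₂ k₃ k₄ 0<a 0<b eq x≤a y≤b h g

fromℚ : ℚ → ℝ
fromℚ q = mkℝ (λ _ → q) (const-cauchy q)

0ᴿ 1ᴿ : ℝ
0ᴿ = fromℚ 0ℚ
1ᴿ = fromℚ 1ℚ

infix  8 -ᴿ_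
infixl 7 _*ᴿ_
infixl 6 _+ᴿ_ _-ᴿ_

_+ᴿ_ _*ᴿ_ : ℝ → ℝ → ℝ
x +ᴿ y = mkℝ (λ n → seq x n ℚ.+ seq y n) (+-cauchy {seq x} {seq y} (cauchy x) (cauchy y))
x *ᴿ y = mkℝ (λ n → seq x n ℚ.* seq y n) (*-cauchy {seq x} {seq y} (cauchy x) (cauchy y))

-ᴿ_ : ℝ → ℝ
-ᴿ x = mkℝ (λ n → ℚ.- seq x n) (neg-cauchy {seq x} (cauchy x))

_-ᴿ_ : ℝ → ℝ → ℝ
x -ᴿ y = x +ᴿ (-ᴿ y)

------------------------------------------------------------------------
-- Complex numbers

record ℂ : Set where
  constructor _+i_
  field
    Re Im : ℝ

open ℂ public

infix 4 _≈_

_≈_ : Rel ℂ 0ℓ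
z ≈ w = Re z ≈ᴿ Re w × Im z ≈ᴿ Im w

infix  8 -_
infixl 7 _*_
infixl 6 _+_

_+_ _*_ : ℂ → ℂ → ℂ
z + w = (Re z +ᴿ Re w) +i (Im z +ᴿ Im w)
z * w = (Re z *ᴿ Re w -ᴿ Im z *ᴿ Im w) +i (Re z *ᴿ Im w +ᴿ Im z *ᴿ Re w)

-_ conj : ℂ → ℂ
- z    = (-ᴿ Re z) +i (-ᴿ Im z)
conj z = Re z +i (-ᴿ Im z)

0ℂ 1ℂ : ℂ
0ℂ = 0ᴿ +i 0ᴿ
1ℂ = 1ᴿ +i 0ᴿ

ℂ-rawRing : RawRing 0ℓ 0ℓ
ℂ-rawRing = record
  { Carrier = ℂ ; _≈_ = _≈_ ; _+_ = _+_ ; _*_ = _*_ ; -_ = -_ ; 0# = 0ℂ ; 1# = 1ℂ }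

IsNegativeReal : ℂ → Set
IsNegativeReal z = Re z <ᴿ 0ᴿ × Im z ≈ᴿ 0ᴿ

-- s = √z for the principal branch: the square root of z whose argument lies
-- in (-π/2 , π/2], i.e. Re s > 0, or Re s = 0 and Im s ≥ 0.  The branch
-- condition is phrased without a disjunction, as the order on ℝ is not
-- decidable.  A relation is used because the principal root, being
-- discontinuous along the negative axis, is not a constructive function on ℂ.
IsPrincipalSqrt : ℂ → ℂ → Set
IsPrincipalSqrt z s =
  s * s ≈ z × 0ᴿ ≤ᴿ Re s × (Re s ≈ᴿ 0ᴿ → 0ᴿ ≤ᴿ Im s)

------------------------------------------------------------------------
-- Rank of a matrix: the dimension of its column space

Matrix : Set → ℕ → ℕ → Set
Matrix A m n = Fin m → Fin n → A

module Rank {c ℓ} (R : RawRing c ℓ) where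
  open RawRing R using (Carrier; 0#; +-rawMonoid)
    renaming (_≈_ to _≈ᵣ_; _*_ to _*ᵣ_)
  open RawMonoidDefinitions +-rawMonoid using (sum)

  linComb : ∀ {m n} → (Fin n → Carrier) → (Fin n → Vector Carrier m) → Vector Carrier m
  linComb a v i = sum (λ j → a j *ᵣ v j i)

  _≈ᵛ_ : ∀ {m} → Rel (Vector Carrier m) ℓ
  v ≈ᵛ w = ∀ i → v i ≈ᵣ w i

  InSpan : ∀ {m n} → (Fin n → Vector Carrier m) → Vector Carrier m → Set _
  InSpan v x = ∃[ a ] (x ≈ᵛ linComb a v)

  LinearlyIndependent : ∀ {m n} → (Fin n → Vector Carrier m) → Set _
  LinearlyIndependent v = ∀ a → linComb a v ≈ᵛ (λ _ → 0#) → ∀ j → a j ≈ᵣ 0#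

  column : ∀ {m n} → (Fin m → Fin n → Carrier) → Fin n → Vector Carrier m
  column M j i = M i j

  record HasRank {m n} (M : Fin m → Fin n → Carrier) (r : ℕ) : Set (c Level.⊔ ℓ) where
    field
      basis       : Fin r → Vector Carrier m
      independent : LinearlyIndependent basis
      inColumns   : ∀ k → InSpan (column M) (basis k)
      spanning    : ∀ j → InSpan basis (column M j)

open Rank ℂ-rawRing public using (HasRank)

------------------------------------------------------------------------
-- Oriented trees

record Tree (n : ℕ) : Set₁ where
  field
    Adj         : Rel (Fin n) 0ℓ
    symmetric   : Symmetric Adj
    irreflexive : Irreflexive _≡_ Adj
    connected   : ∀ u v → Star Adj u v
    -- A cycle is v, x₁, …, xₖ, v with k ≥ 2 and v, x₁, …, xₖ distinct.
    acyclic     : ∀ v xs → 2 ℕ.≤ length xs → Unique (v ∷ xs) →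
                  ¬ Linked Adj (v ∷ xs ++ v ∷ [])

record OrientedTree (n : ℕ) : Set₁ where
  field
    tree       : Tree n
  open Tree tree public
  field
    Arc        : Rel (Fin n) 0ℓ
    arc⇒adj    : ∀ {u v} → Arc u v → Adj u v
    adj⇒arc    : ∀ {u v} → Adj u v → Arc u v ⊎ Arc v u
    asymmetric : Asymmetric Arc

-- A listing e₁, …, eₙ₋₁ of the directed edges, each as (tail , head).
record EdgeListing {n} (G : OrientedTree n) : Set where
  open OrientedTree G using (Arc)
  field
    edge      : Fin (n ∸ 1) → Fin n × Fin n
    isArc     : ∀ j → uncurry Arc (edge j)
    injective : Injective _≡_ _≡_ edge
    complete  : ∀ {u v} → Arc u v → ∃[ j ] edge j ≡ (u , v)

-- Only the values w u v at directed edges (u , v) matter.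
Weighting : ℕ → Set
Weighting n = Fin n → Fin n → ℂ

record IsSignlessIncidence {n} {G : OrientedTree n} (E : EdgeListing G) (w : Weighting n)
                           (N : Matrix ℂ n (n ∸ 1)) : Set where
  open EdgeListing E using (edge)
  field
    atTail    : ∀ {j u v} → edge j ≡ (u , v) → IsPrincipalSqrt (w u v) (N u j)
    atHead    : ∀ {j u v} → edge j ≡ (u , v) → IsPrincipalSqrt (conj (w u v)) (N v j)
    elsewhere : ∀ {j u v} → edge j ≡ (u , v) → ∀ i → i ≢ u → i ≢ v → N i j ≈ 0ℂ

{-# OPTIONS --safe #-}

-- The columns of N themselves form the basis. Let Σ aⱼ Nᵢⱼ = 0 for all i and let e join u and v.
-- Grow a simple path that enters v from u: every further edge at v leads, by acyclicity,
-- to a vertex off the path, so by induction on the number of vertices off the path its coefficient vanishes.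
-- Row v of the relation then reduces to aₑ Nᵥₑ = 0, and Nᵥₑ ≠ 0 since its square is a weight or the conjugate of one.
module Submission where

open import Defs
open import Data.Nat using (ℕ; _≤_; _∸_)
open import Relation.Nullary using (¬_)

open import Level using (0ℓ; _⊔_)
open import Algebra.Bundles.Raw using (RawRing)
open import Algebra.Structures using (IsRing)
open import Algebra.Bundles using (CommutativeMonoid; CommutativeRing; Ring)
import Algebra.Properties.CommutativeMonoid.Sum as Sum
open import Data.Bool.Base using (if_then_else_)
open import Data.Fin.Base using (Fin; punchIn)
import Data.Fin.Properties as Fin
open import Data.List.Base using (List; []; _∷_; _++_; length; lookup)
open import Data.List.Membership.Propositional using (_∈_)
open import Data.List.Membership.Propositional.Properties using (∈-∃++; ∈-lookup)
open import Data.List.Relation.Unary.All as All using (All; []; _∷_)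
import Data.List.Relation.Unary.All.Properties as All
open import Data.List.Relation.Unary.AllPairs using ([]; _∷_)
open import Data.List.Relation.Unary.Linked using (Linked; [-]; _∷_)
open import Data.List.Relation.Unary.Unique.Propositional using (Unique)
import Data.Integer.Base as ℤ
import Data.Nat.Base as ℕ
import Data.Nat.Properties as ℕ
open import Data.Product.Base using (_×_; _,_; ∃-syntax; proj₁; proj₂)
open import Data.Rational.Base as ℚ using (ℚ; 0ℚ; 1ℚ; ½)
import Data.Rational.Properties as ℚ
open import Data.Rational.Solver using (module +-*-Solver)
open import Data.Sum.Base using (_⊎_; inj₁; inj₂)
open import Data.Vec.Functional using (Vector)
open import Function.Base using (_∘_)
open import Function.Definitions using (Injective)
open import Relation.Binary.Core using (Rel)
open import Relation.Binary.Bundles using (Setoid)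
open import Relation.Binary.Structures using (IsEquivalence)
import Relation.Binary.Reasoning.Setoid as SetoidReasoning
open import Relation.Binary.PropositionalEquality
  using (_≡_; _≢_; refl; sym; trans; cong; subst)
open import Relation.Nullary using (yes; no; does; contradiction)
open import Relation.Nullary.Decidable using (dec-true; dec-false)

open +-*-Solver using (solve; _:=_; _:+_; _:*_; _:-_; :-_; con)

-- Finite sums and rank

module _ {c ℓ} (M : CommutativeMonoid c ℓ) where
  open CommutativeMonoid M using (Carrier; ∙-congˡ; identityʳ)
    renaming (_≈_ to _≈ₘ_; ε to 0ₘ; trans to transₘ)
  open Sum M using (sum; sum-remove; sum-cong-≋; sum-replicate-zero)

  sum-single : ∀ {n} (t : Vector Carrier n) i → (∀ k → k ≢ i → t k ≈ₘ 0ₘ) → sum t ≈ₘ t i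
  sum-single {ℕ.suc n} t i t≈0 = transₘ (sum-remove {i = i} t)
    (transₘ (∙-congˡ (transₘ (sum-cong-≋ λ k → t≈0 (punchIn i k) (Fin.punchInᵢ≢i i k)) (sum-replicate-zero n)))
      (identityʳ (t i)))

-- `Rank` is built over a raw ring, so the laws come as a separate argument; the sums and spans
-- below are then literally those of `HasRank`.
RingLaws : ∀ {c ℓ} → RawRing c ℓ → Set (c ⊔ ℓ)
RingLaws R = IsRing _≈ᵣ_ _+ᵣ_ _*ᵣ_ -ᵣ_ 0# 1#
  where open RawRing R renaming (_≈_ to _≈ᵣ_; _+_ to _+ᵣ_; _*_ to _*ᵣ_; -_ to -ᵣ_)

toRing : ∀ {c ℓ} (R : RawRing c ℓ) → RingLaws R → Ring c ℓ
toRing R isRing = record { isRing = isRing }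

module _ {c ℓ} (R : RawRing c ℓ) (isRing : RingLaws R) where
  open RawRing R using (Carrier; 0#; 1#) renaming (_≈_ to _≈ᵣ_; _*_ to _*ᵣ_)
  open Ring (toRing R isRing) using (setoid; +-commutativeMonoid; *-identityˡ; zeroˡ)
  open Setoid setoid using () renaming (sym to symᵣ)
  open SetoidReasoning setoid
  open Rank R

  kronecker : ∀ {n} → Fin n → Fin n → Carrier
  kronecker i j = if does (i Fin.≟ j) then 1# else 0#

  kronecker-diagonal : ∀ {n} (i : Fin n) → kronecker i i ≡ 1#
  kronecker-diagonal i = cong (if_then 1# else 0#) (dec-true (i Fin.≟ i) refl)

  kronecker-off-diagonal : ∀ {n} {i j : Fin n} → i ≢ j → kronecker i j ≡ 0#
  kronecker-off-diagonal {i = i} {j} i≢j = cong (if_then 1# else 0#) (dec-false (i Fin.≟ j) i≢j)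

  -- The coefficients are a row of the identity matrix, so `sum-single` leaves one term.
  ∈-span : ∀ {m n} (v : Fin n → Vector Carrier m) j → InSpan v (v j)
  ∈-span v j = kronecker j , λ i → symᵣ (begin
    linComb (kronecker j) v i
      ≈⟨ sum-single +-commutativeMonoid (λ k → kronecker j k *ᵣ v k i) j (λ k k≢j → begin
           kronecker j k *ᵣ v k i  ≡⟨ cong (_*ᵣ v k i) (kronecker-off-diagonal (k≢j ∘ sym)) ⟩
           0# *ᵣ v k i             ≈⟨ zeroˡ (v k i) ⟩
           0#                      ∎) ⟩
    kronecker j j *ᵣ v j i
      ≡⟨ cong (_*ᵣ v j i) (kronecker-diagonal j) ⟩
    1# *ᵣ v j i
      ≈⟨ *-identityˡ (v j i) ⟩
    v j i ∎)

  -- The columns are their own basis, so both span conditions are instances of `∈-span`.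
  independent⇒hasRank : ∀ {m n} (M : Fin m → Fin n → Carrier) →
    LinearlyIndependent (λ j i → M i j) → Rank.HasRank R M n
  independent⇒hasRank M independent = record
    { basis       = column M
    ; independent = independent
    ; inColumns   = ∈-span (column M)
    ; spanning    = ∈-span (column M)
    }

-- Cancellation is all that the linear algebra asks of an entry. Invertibility would call for a
-- positive lower bound on the modulus, which the negation of `≈ 0ℂ` does not provide
-- constructively.
RightRegular : ∀ {c ℓ} (R : RawRing c ℓ) → RawRing.Carrier R → Set (c ⊔ ℓ)
RightRegular R s = ∀ z → z *ᵣ s ≈ᵣ 0# → z ≈ᵣ 0#
  where open RawRing R using (0#) renaming (_≈_ to _≈ᵣ_; _*_ to _*ᵣ_)

-- Simple paths

module _ {A : Set} where

  unique⇒lookup-injective : ∀ {xs : List A} → Unique xs → Injective _≡_ _≡_ (lookup xs)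
  unique⇒lookup-injective {_ ∷ _} _ {Fin.zero} {Fin.zero} _ = refl
  unique⇒lookup-injective {_ ∷ xs} (x∉ ∷ _) {Fin.zero} {Fin.suc j} eq =
    contradiction eq (All.lookup x∉ (∈-lookup j))
  unique⇒lookup-injective {_ ∷ xs} (x∉ ∷ _) {Fin.suc i} {Fin.zero} eq =
    contradiction (sym eq) (All.lookup x∉ (∈-lookup i))
  unique⇒lookup-injective {_ ∷ _} (_ ∷ u) {Fin.suc i} {Fin.suc j} eq =
    cong Fin.suc (unique⇒lookup-injective u eq)

  -- A path is cut at `w` and `w` moves to the front, where `acyclic` expects the base point of a
  -- cycle.
  unique-prefix : ∀ xs {w : A} {zs} → Unique (xs ++ w ∷ zs) → Unique (w ∷ xs)
  unique-prefix [] _ = [] ∷ []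
  unique-prefix (x ∷ xs) (x∉ ∷ u) with unique-prefix xs u
  ... | w∉ ∷ u′ = ((All.head (All.++⁻ʳ xs x∉) ∘ sym) ∷ w∉) ∷ (All.++⁻ˡ xs x∉ ∷ u′)

  -- The cut vertex stays at the end, where it closes the cycle.
  linked-prefix : ∀ {R : Rel A 0ℓ} xs {w zs} → Linked R (xs ++ w ∷ zs) → Linked R (xs ++ w ∷ [])
  linked-prefix []           _       = [-]
  linked-prefix (x ∷ [])     (r ∷ _) = r ∷ [-]
  linked-prefix (x ∷ y ∷ xs) (r ∷ l) = r ∷ linked-prefix (y ∷ xs) l

-- Pigeonhole: the positions of the list inject into `Fin n`. This bound ends the growth of the
-- path.
unique-length≤ : ∀ {n} {xs : List (Fin n)} → Unique xs → length xs ≤ n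
unique-length≤ u = Fin.injective⇒≤ (unique⇒lookup-injective u)

-- Irreflexivity excludes `v` and a hypothesis excludes `u`; meeting the path any later would close
-- a cycle.
extension-avoids-path : ∀ {n} (T : Tree n) → let open Tree T in ∀ {w v u xs} →
  Linked Adj (v ∷ u ∷ xs) → Unique (v ∷ u ∷ xs) → Adj w v → w ≢ u →
  All (w ≢_) (v ∷ u ∷ xs)
extension-avoids-path T {w} {v} {u} {xs} path simple wv w≢u =
  (λ w≡v → irreflexive w≡v wv) ∷ w≢u ∷ All.¬Any⇒All¬ xs closes-cycle
  where
  open Tree T
  closes-cycle : ¬ (w ∈ xs)
  closes-cycle w∈xs with ∈-∃++ w∈xs
  -- The path reads `v ∷ u ∷ ys` before it reaches `w`, so `v` and `u` are the two further vertices
  -- that a cycle must have.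
  ... | ys , zs , refl = acyclic w (v ∷ u ∷ ys) (ℕ.s≤s (ℕ.s≤s ℕ.z≤n))
    (unique-prefix (v ∷ u ∷ ys) simple)
    (wv ∷ linked-prefix (v ∷ u ∷ ys) path)

-- Independence of the columns

module _ {n} {G : OrientedTree n} (E : EdgeListing G) where
  open OrientedTree G
  open EdgeListing E

  -- Orientation is forgotten, since the path may traverse an edge against its direction.
  Joins : Fin (n ∸ 1) → Fin n → Fin n → Set
  Joins j u v = edge j ≡ (u , v) ⊎ edge j ≡ (v , u)

  edge⇒arc : ∀ {j u v} → edge j ≡ (u , v) → Arc u v
  edge⇒arc {j} eq with edge j | isArc j
  edge⇒arc refl | _ | arc = arc

  joins⇒adj : ∀ {j u v} → Joins j u v → Adj u v
  joins⇒adj (inj₁ eq) = arc⇒adj (edge⇒arc eq)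
  joins⇒adj (inj₂ eq) = symmetric (arc⇒adj (edge⇒arc eq))

  -- Equal orientations are settled by injectivity of the listing; opposite ones would give arcs
  -- both ways, against asymmetry.
  joins-unique : ∀ {j k u v} → Joins j u v → Joins k u v → j ≡ k
  joins-unique (inj₁ p) (inj₁ q) = injective (trans p (sym q))
  joins-unique (inj₂ p) (inj₂ q) = injective (trans p (sym q))
  joins-unique (inj₁ p) (inj₂ q) = contradiction (edge⇒arc q) (asymmetric (edge⇒arc p))
  joins-unique (inj₂ p) (inj₁ q) = contradiction (edge⇒arc q) (asymmetric (edge⇒arc p))

  joins-swap : ∀ {j u v} → Joins j u v → Joins j v u
  joins-swap (inj₁ eq) = inj₂ eq
  joins-swap (inj₂ eq) = inj₁ eq

  module _ {c ℓ} (R : RawRing c ℓ) (isRing : RingLaws R) where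
    open RawRing R using (Carrier; 0#) renaming (_≈_ to _≈ᵣ_; _*_ to _*ᵣ_)
    open Ring (toRing R isRing)
      using (setoid; +-commutativeMonoid; *-congˡ; *-congʳ; zeroˡ; zeroʳ)
    open SetoidReasoning setoid
    open Rank R hiding (HasRank)

    module _ (N : Fin n → Fin (n ∸ 1) → Carrier)
      (ends-regular : ∀ {j u v} → Joins j u v → RightRegular R (N u j))
      (elsewhere : ∀ {j u v} → edge j ≡ (u , v) → ∀ i → i ≢ u → i ≢ v → N i j ≈ᵣ 0#)
      (a : Fin (n ∸ 1) → Carrier) (relation : ∀ i → linComb a (λ j i → N i j) i ≈ᵣ 0#)
      where

      -- The newest vertex is the head of the list, so extending the path is a cons. Each extension
      -- trades one unit of `fuel` for one vertex and keeps the strict bound; with no fuel left, a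
      -- simple path would have more than `n` vertices.
      coefficient-vanishes : ∀ fuel {v u xs j} → n ℕ.< fuel ℕ.+ length (v ∷ u ∷ xs) →
        Linked Adj (v ∷ u ∷ xs) → Unique (v ∷ u ∷ xs) → Joins j v u → a j ≈ᵣ 0#
      coefficient-vanishes ℕ.zero n<len path simple _ =
        contradiction (unique-length≤ simple) (ℕ.<⇒≱ n<len)
      coefficient-vanishes (ℕ.suc fuel) {v} {u} {xs} {j} n<len path simple joins =
        ends-regular joins (a j) (begin
          a j *ᵣ N v j                 ≈⟨ sum-single +-commutativeMonoid (λ k → a k *ᵣ N v k) j other-term≈0 ⟨
          linComb a (λ j i → N i j) v  ≈⟨ relation v ⟩
          0#                           ∎)
        where
        next≈0 : ∀ {k w} → k ≢ j → Joins k w v → a k ≈ᵣ 0#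
        next≈0 {k} {w} k≢j joins′ = coefficient-vanishes fuel
          (subst (n ℕ.<_) (sym (ℕ.+-suc fuel (length (v ∷ u ∷ xs)))) n<len)
          (joins⇒adj joins′ ∷ path)
          (extension-avoids-path tree path simple (joins⇒adj joins′) w≢u ∷ simple)
          joins′
          where
          w≢u : w ≢ u
          -- Were `w` equal to `u`, edge `k` would have the same ends as `j`.
          w≢u refl = k≢j (joins-unique (joins-swap joins′) joins)

        other-term≈0 : ∀ k → k ≢ j → a k *ᵣ N v k ≈ᵣ 0#
        other-term≈0 k k≢j with edge k in eq
        -- If `v` is an end of edge `k`, the other end extends the path and `a k` vanishes by
        -- recursion; otherwise the entry `N v k` vanishes.
        ... | x , y with v Fin.≟ x | v Fin.≟ y
        ...   | no v≢x   | no v≢y   = begin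
          a k *ᵣ N v k  ≈⟨ *-congˡ (elsewhere eq v v≢x v≢y) ⟩
          a k *ᵣ 0#     ≈⟨ zeroʳ (a k) ⟩
          0#            ∎
        ...   | yes refl | _        = begin
          a k *ᵣ N v k  ≈⟨ *-congʳ (next≈0 k≢j (inj₂ eq)) ⟩
          0# *ᵣ N v k   ≈⟨ zeroˡ (N v k) ⟩
          0#            ∎
        ...   | no _     | yes refl = begin
          a k *ᵣ N v k  ≈⟨ *-congʳ (next≈0 k≢j (inj₁ eq)) ⟩
          0# *ᵣ N v k   ≈⟨ zeroˡ (N v k) ⟩
          0#            ∎

      coefficients-vanish : ∀ j → a j ≈ᵣ 0#
      -- The initial path is edge `j` alone; its two vertices make fuel `n` enough for the strict
      -- bound.
      coefficients-vanish j = coefficient-vanishes n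
        (ℕ.≤-trans (ℕ.≤-reflexive (ℕ.+-comm 1 n)) (ℕ.+-monoʳ-≤ n (ℕ.s≤s ℕ.z≤n)))
        (adj ∷ [-])
        (((λ eq → irreflexive eq adj) ∷ []) ∷ [] ∷ [])
        (inj₁ refl)
        where
        adj : Adj (proj₁ (edge j)) (proj₂ (edge j))
        adj = arc⇒adj (isArc j)

-- Null sequences of rationals

Eventually : (ℕ → Set) → Set
Eventually P = ∃[ k ] (∀ n → k ≤ n → P n)

eventually-map₂ : {P Q R : ℕ → Set} → (∀ n → P n → Q n → R n) →
  Eventually P → Eventually Q → Eventually R
eventually-map₂ f (k , p) (l , q) = k ℕ.⊔ l , λ n k⊔l≤n →
  f n (p n (ℕ.m⊔n≤o⇒m≤o k l k⊔l≤n)) (q n (ℕ.m⊔n≤o⇒n≤o k l k⊔l≤n))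

-- `x ≈ᴿ y` unfolds to this property of the sequence of differences, so equalities of reals become
-- statements about null sequences.
Null : (ℕ → ℚ) → Set
Null x = ∀ ε → 0ℚ ℚ.< ε → Eventually (λ n → ℚ.∣ x n ∣ ℚ.< ε)

*-pos : ∀ {p q} → 0ℚ ℚ.< p → 0ℚ ℚ.< q → 0ℚ ℚ.< p ℚ.* q
*-pos {p} {q} 0<p 0<q =
  ℚ.positive⁻¹ (p ℚ.* q) {{ℚ.pos*pos⇒pos p {{ℚ.positive 0<p}} q {{ℚ.positive 0<q}}}}

null-resp : ∀ {x y : ℕ → ℚ} → (∀ n → x n ≡ y n) → Null x → Null y
null-resp {x} {y} eq nx ε 0<ε = let k , h = nx ε 0<ε in k , λ n k≤n →
  subst (λ q → ℚ.∣ q ∣ ℚ.< ε) (eq n) (h n k≤n)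

null-zero : Null (λ _ → 0ℚ)
null-zero ε 0<ε = 0 , λ _ _ → 0<ε

null-neg : ∀ {x} → Null x → Null (λ n → ℚ.- x n)
null-neg {x} nx ε 0<ε = let k , h = nx ε 0<ε in k , λ n k≤n →
  subst (ℚ._< ε) (sym (ℚ.∣-p∣≡∣p∣ (x n))) (h n k≤n)

null-+ : ∀ {x y} → Null x → Null y → Null (λ n → x n ℚ.+ y n)
null-+ {x} {y} nx ny ε 0<ε =
  eventually-map₂ (λ n x<δ y<δ → begin-strict
      ℚ.∣ x n ℚ.+ y n ∣          ≤⟨ ℚ.∣p+q∣≤∣p∣+∣q∣ (x n) (y n) ⟩
      ℚ.∣ x n ∣ ℚ.+ ℚ.∣ y n ∣    <⟨ ℚ.+-mono-< x<δ y<δ ⟩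
      ½ ℚ.* ε ℚ.+ ½ ℚ.* ε        ≡⟨ solve 1 (λ e → con ½ :* e :+ con ½ :* e := e) refl ε ⟩
      ε                          ∎)
    (nx (½ ℚ.* ε) 0<δ) (ny (½ ℚ.* ε) 0<δ)
  where
  open ℚ.≤-Reasoning
  0<δ : 0ℚ ℚ.< ½ ℚ.* ε
  0<δ = *-pos (ℚ.positive⁻¹ ½) 0<ε

-- Once `x` is below `δ * ε`, cancelling `δ` puts `y` below `ε`. With `δ` on the side of `y`, it can
-- be the inverse of an upper bound, as in `null-*`, or a lower bound, as in `null-cancel`.
null-dominated : ∀ {x y δ} → 0ℚ ℚ.< δ →
  Eventually (λ n → δ ℚ.* ℚ.∣ y n ∣ ℚ.≤ ℚ.∣ x n ∣) → Null x → Null y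
null-dominated {x} {y} {δ} 0<δ dom nx ε 0<ε =
  eventually-map₂ (λ n δy≤x x<δε → ℚ.*-cancelˡ-<-nonNeg δ {{δ≥0}} (ℚ.≤-<-trans δy≤x x<δε))
    dom (nx (δ ℚ.* ε) (*-pos 0<δ 0<ε))
  where
  δ≥0 : ℚ.NonNegative δ
  δ≥0 = ℚ.nonNegative (ℚ.<⇒≤ 0<δ)

∣p∣≤∣p-q∣+∣q∣ : ∀ p q → ℚ.∣ p ∣ ℚ.≤ ℚ.∣ p ℚ.- q ∣ ℚ.+ ℚ.∣ q ∣
∣p∣≤∣p-q∣+∣q∣ p q = subst (λ r → ℚ.∣ r ∣ ℚ.≤ ℚ.∣ p ℚ.- q ∣ ℚ.+ ℚ.∣ q ∣)
  (solve 2 (λ p q → (p :- q) :+ q := p) refl p q) (ℚ.∣p+q∣≤∣p∣+∣q∣ (p ℚ.- q) q)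

-- The tail stays within 1 of `x k`, hence below `b = 1 + ∣ x k ∣`. The bound is given through its
-- inverse, the form that `null-dominated` takes.
bounded : ∀ {x} → IsCauchy x →
  ∃[ δ ] (0ℚ ℚ.< δ × Eventually (λ n → δ ℚ.* ℚ.∣ x n ∣ ℚ.≤ 1ℚ))
bounded {x} cx with cx 1ℚ (ℚ.positive⁻¹ 1ℚ)
... | k , h = δ , ℚ.positive⁻¹ δ , k , λ n k≤n → begin
    δ ℚ.* ℚ.∣ x n ∣  ≤⟨ ℚ.*-monoˡ-≤-nonNeg δ {{ℚ.pos⇒nonNeg δ}} (x≤b n k≤n) ⟩
    δ ℚ.* b          ≡⟨ ℚ.*-inverseˡ b ⟩
    1ℚ               ∎
  where
  open ℚ.≤-Reasoning
  b : ℚ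
  b = 1ℚ ℚ.+ ℚ.∣ x k ∣
  instance
    b>0 : ℚ.Positive b
    b>0 = ℚ.pos+nonNeg⇒pos 1ℚ ℚ.∣ x k ∣ {{ℚ.∣-∣-nonNeg (x k)}}
    b≢0 : ℚ.NonZero b
    b≢0 = ℚ.pos⇒nonZero b
  δ : ℚ
  δ = ℚ.1/ b
  instance
    δ>0 : ℚ.Positive δ
    δ>0 = ℚ.1/pos⇒pos b
  x≤b : ∀ n → k ≤ n → ℚ.∣ x n ∣ ℚ.≤ b
  x≤b n k≤n = ℚ.≤-trans (∣p∣≤∣p-q∣+∣q∣ (x n) (x k))
    (ℚ.+-monoˡ-≤ ℚ.∣ x k ∣ (ℚ.<⇒≤ (h n k k≤n ℕ.≤-refl)))

null-* : ∀ {x y} → IsCauchy x → Null y → Null (λ n → x n ℚ.* y n)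
null-* {x} {y} cx ny =
  let δ , 0<δ , k , h = bounded {x} cx in
  null-dominated {y} {λ n → x n ℚ.* y n} 0<δ
    (k , λ n k≤n → begin
      δ ℚ.* ℚ.∣ x n ℚ.* y n ∣              ≡⟨ cong (δ ℚ.*_) (ℚ.∣p*q∣≡∣p∣*∣q∣ (x n) (y n)) ⟩
      δ ℚ.* (ℚ.∣ x n ∣ ℚ.* ℚ.∣ y n ∣)      ≡⟨ ℚ.*-assoc δ ℚ.∣ x n ∣ ℚ.∣ y n ∣ ⟨
      δ ℚ.* ℚ.∣ x n ∣ ℚ.* ℚ.∣ y n ∣        ≤⟨ ℚ.*-monoʳ-≤-nonNeg ℚ.∣ y n ∣ {{ℚ.∣-∣-nonNeg (y n)}} (h n k≤n) ⟩
      1ℚ ℚ.* ℚ.∣ y n ∣                     ≡⟨ ℚ.*-identityˡ ℚ.∣ y n ∣ ⟩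
      ℚ.∣ y n ∣                            ∎)
    ny
  where open ℚ.≤-Reasoning

-- Cancelling a factor that is not null

third : ℚ
third = ℤ.+ 1 ℚ./ 3

-- A constructive substitute for deciding whether the limit is zero. With `k` a Cauchy index for
-- `δ = ε / 3`, the single rational `∣ x k ∣` is compared with `2δ`: the tail differs from `x k` by
-- less than `δ`, so it stays below `3δ = ε` in one case and at or above `δ` in the other.
cauchy-small-or-apart : ∀ {x} → IsCauchy x → ∀ ε → 0ℚ ℚ.< ε →
  Eventually (λ n → ℚ.∣ x n ∣ ℚ.< ε) ⊎
  ∃[ δ ] (0ℚ ℚ.< δ × Eventually (λ n → δ ℚ.≤ ℚ.∣ x n ∣))
cauchy-small-or-apart {x} cx ε 0<ε = dichotomy (cx δ 0<δ)
  where
  open ℚ.≤-Reasoning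
  δ : ℚ
  δ = third ℚ.* ε
  0<δ : 0ℚ ℚ.< δ
  0<δ = *-pos (ℚ.positive⁻¹ third) 0<ε
  dichotomy : ∃[ k ] (∀ m n → k ≤ m → k ≤ n → ℚ.∣ x m ℚ.- x n ∣ ℚ.< δ) → _
  dichotomy (k , h) with ℚ.∣ x k ∣ ℚ.≤? δ ℚ.+ δ
  ... | yes xₖ≤2δ = inj₁ (k , λ n k≤n → begin-strict
    ℚ.∣ x n ∣                          ≤⟨ ∣p∣≤∣p-q∣+∣q∣ (x n) (x k) ⟩
    ℚ.∣ x n ℚ.- x k ∣ ℚ.+ ℚ.∣ x k ∣    <⟨ ℚ.+-mono-<-≤ (h n k k≤n ℕ.≤-refl) xₖ≤2δ ⟩
    δ ℚ.+ (δ ℚ.+ δ)                    ≡⟨ solve 1 (λ e → con third :* e :+ (con third :* e :+ con third :* e) := e) refl ε ⟩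
    ε                                  ∎)
  ... | no xₖ≰2δ = inj₂ (δ , 0<δ , k , λ n k≤n → ℚ.≮⇒≥ λ xₙ<δ → xₖ≰2δ (begin
    ℚ.∣ x k ∣                          ≤⟨ ∣p∣≤∣p-q∣+∣q∣ (x k) (x n) ⟩
    ℚ.∣ x k ℚ.- x n ∣ ℚ.+ ℚ.∣ x n ∣    ≤⟨ ℚ.+-mono-≤ (ℚ.<⇒≤ (h k n ℕ.≤-refl k≤n)) (ℚ.<⇒≤ xₙ<δ) ⟩
    δ ℚ.+ δ                            ∎))

-- For every ε either x is eventually smaller than ε, or x is bounded away from 0 and then y would be null.
null-cancel : ∀ {x y} → IsCauchy x → Null (λ n → x n ℚ.* y n) → ¬ Null y → Null x
null-cancel {x} {y} cx nxy ¬ny ε 0<ε with cauchy-small-or-apart {x} cx ε 0<ε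
... | inj₁ small = small
... | inj₂ (δ , 0<δ , k , δ≤x) = contradiction
  (null-dominated {λ n → x n ℚ.* y n} {y} 0<δ
    (k , λ n k≤n → subst (δ ℚ.* ℚ.∣ y n ∣ ℚ.≤_) (sym (ℚ.∣p*q∣≡∣p∣*∣q∣ (x n) (y n)))
      (ℚ.*-monoʳ-≤-nonNeg ℚ.∣ y n ∣ {{ℚ.∣-∣-nonNeg (y n)}} (δ≤x n k≤n)))
    nxy)
  ¬ny

*-self-nonNeg : ∀ p → 0ℚ ℚ.≤ p ℚ.* p
*-self-nonNeg p with ℚ.≤-total 0ℚ p
... | inj₁ 0≤p = ℚ.nonNegative⁻¹ (p ℚ.* p)
  {{ℚ.nonNeg*nonNeg⇒nonNeg p {{ℚ.nonNegative 0≤p}} p {{ℚ.nonNegative 0≤p}}}}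
... | inj₂ p≤0 = ℚ.nonNegative⁻¹ (p ℚ.* p)
  {{ℚ.nonPos*nonPos⇒nonPos p {{ℚ.nonPositive p≤0}} p {{ℚ.nonPositive p≤0}}}}

∣p∣*∣p∣≤∣p*p+q*q∣ : ∀ p q → ℚ.∣ p ∣ ℚ.* ℚ.∣ p ∣ ℚ.≤ ℚ.∣ p ℚ.* p ℚ.+ q ℚ.* q ∣
∣p∣*∣p∣≤∣p*p+q*q∣ p q = begin
  ℚ.∣ p ∣ ℚ.* ℚ.∣ p ∣          ≡⟨ ℚ.∣p*q∣≡∣p∣*∣q∣ p p ⟨
  ℚ.∣ p ℚ.* p ∣                ≡⟨ ℚ.0≤p⇒∣p∣≡p (*-self-nonNeg p) ⟩
  p ℚ.* p                      ≡⟨ ℚ.+-identityʳ (p ℚ.* p) ⟨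
  p ℚ.* p ℚ.+ 0ℚ               ≤⟨ 0-step ⟩
  p ℚ.* p ℚ.+ q ℚ.* q          ≡⟨ ℚ.0≤p⇒∣p∣≡p 0≤sum ⟨
  ℚ.∣ p ℚ.* p ℚ.+ q ℚ.* q ∣    ∎
  where
  open ℚ.≤-Reasoning
  0-step = ℚ.+-monoʳ-≤ (p ℚ.* p) (*-self-nonNeg q)
  0≤sum : 0ℚ ℚ.≤ p ℚ.* p ℚ.+ q ℚ.* q
  0≤sum = ℚ.≤-trans (*-self-nonNeg p)
    (subst (ℚ._≤ p ℚ.* p ℚ.+ q ℚ.* q) (ℚ.+-identityʳ (p ℚ.* p)) 0-step)

-- The hypothesis is tested at `ε * ε`: as squares are non-negative, `ε ≤ ∣ x n ∣` would push the
-- sum up to at least `ε * ε`.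
null-sum-of-squares : ∀ {x y : ℕ → ℚ} → Null (λ n → x n ℚ.* x n ℚ.+ y n ℚ.* y n) → Null x
null-sum-of-squares {x} {y} n² ε 0<ε = let k , h = n² (ε ℚ.* ε) (*-pos 0<ε 0<ε) in
  k , λ n k≤n → ℚ.≰⇒> λ ε≤x → ℚ.<-irrefl refl (begin-strict
    ε ℚ.* ε                                ≤⟨ ℚ.*-monoˡ-≤-nonNeg ε {{ℚ.nonNegative (ℚ.<⇒≤ 0<ε)}} ε≤x ⟩
    ε ℚ.* ℚ.∣ x n ∣                        ≤⟨ ℚ.*-monoʳ-≤-nonNeg ℚ.∣ x n ∣ {{ℚ.∣-∣-nonNeg (x n)}} ε≤x ⟩
    ℚ.∣ x n ∣ ℚ.* ℚ.∣ x n ∣                ≤⟨ ∣p∣*∣p∣≤∣p*p+q*q∣ (x n) (y n) ⟩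
    ℚ.∣ x n ℚ.* x n ℚ.+ y n ℚ.* y n ∣      <⟨ h n k≤n ⟩
    ε ℚ.* ε                                ∎)
  where open ℚ.≤-Reasoning

-- Real and complex numbers

-- Real arithmetic is termwise, so the ring laws reduce to identities of rationals at each index.
pointwise⇒≈ᴿ : ∀ x y → (∀ n → seq x n ≡ seq y n) → x ≈ᴿ y
pointwise⇒≈ᴿ x y eq = null-resp
  (λ n → sym (trans (cong (λ q → q ℚ.- seq y n) (eq n)) (ℚ.+-inverseʳ (seq y n)))) null-zero

≈ᴿ-refl : ∀ x → x ≈ᴿ x
≈ᴿ-refl x = pointwise⇒≈ᴿ x x λ _ → refl

≈ᴿ-sym : ∀ x y → x ≈ᴿ y → y ≈ᴿ x
≈ᴿ-sym x y x≈y = null-resp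
  (λ n → solve 2 (λ x y → :- (x :- y) := y :- x) refl (seq x n) (seq y n))
  (null-neg {λ n → seq x n ℚ.- seq y n} x≈y)

≈ᴿ-trans : ∀ x y z → x ≈ᴿ y → y ≈ᴿ z → x ≈ᴿ z
≈ᴿ-trans x y z x≈y y≈z = null-resp
  (λ n → solve 3 (λ x y z → (x :- y) :+ (y :- z) := x :- z) refl (seq x n) (seq y n) (seq z n))
  (null-+ {λ n → seq x n ℚ.- seq y n} {λ n → seq y n ℚ.- seq z n} x≈y y≈z)

+ᴿ-cong : ∀ x y u v → x ≈ᴿ y → u ≈ᴿ v → x +ᴿ u ≈ᴿ y +ᴿ v
+ᴿ-cong x y u v x≈y u≈v = null-resp
  (λ n → solve 4 (λ x y u v → (x :- y) :+ (u :- v) := (x :+ u) :- (y :+ v)) refl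
    (seq x n) (seq y n) (seq u n) (seq v n))
  (null-+ {λ n → seq x n ℚ.- seq y n} {λ n → seq u n ℚ.- seq v n} x≈y u≈v)

-ᴿ-cong : ∀ x y → x ≈ᴿ y → -ᴿ x ≈ᴿ -ᴿ y
-ᴿ-cong x y x≈y = null-resp
  (λ n → solve 2 (λ x y → :- (x :- y) := :- x :- (:- y)) refl (seq x n) (seq y n))
  (null-neg {λ n → seq x n ℚ.- seq y n} x≈y)

-- In `x * u - y * v = x * (u - v) + v * (x - y)` each summand is a Cauchy sequence times a null
-- one.
*ᴿ-cong : ∀ x y u v → x ≈ᴿ y → u ≈ᴿ v → x *ᴿ u ≈ᴿ y *ᴿ v
*ᴿ-cong x y u v x≈y u≈v = null-resp
  (λ n → solve 4 (λ x y u v → x :* (u :- v) :+ v :* (x :- y) := x :* u :- y :* v) refl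
    (seq x n) (seq y n) (seq u n) (seq v n))
  (null-+ {λ n → seq x n ℚ.* (seq u n ℚ.- seq v n)} {λ n → seq v n ℚ.* (seq x n ℚ.- seq y n)}
    (null-* {seq x} {λ n → seq u n ℚ.- seq v n} (cauchy x) u≈v)
    (null-* {seq v} {λ n → seq x n ℚ.- seq y n} (cauchy v) x≈y))

≈0ᴿ⇒null : ∀ x → x ≈ᴿ 0ᴿ → Null (seq x)
≈0ᴿ⇒null x = null-resp (λ n → solve 1 (λ x → x :- con 0ℚ := x) refl (seq x n))

null⇒≈0ᴿ : ∀ x → Null (seq x) → x ≈ᴿ 0ᴿ
null⇒≈0ᴿ x = null-resp (λ n → solve 1 (λ x → x := x :- con 0ℚ) refl (seq x n))

pointwise⇒≈ : ∀ z w → (∀ n → seq (Re z) n ≡ seq (Re w) n) → (∀ n → seq (Im z) n ≡ seq (Im w) n) →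
  z ≈ w
pointwise⇒≈ z w re im = pointwise⇒≈ᴿ (Re z) (Re w) re , pointwise⇒≈ᴿ (Im z) (Im w) im

≈-isEquivalence : IsEquivalence _≈_
≈-isEquivalence = record
  { refl  = λ {z} → ≈ᴿ-refl (Re z) , ≈ᴿ-refl (Im z)
  ; sym   = λ {z} {w} (r , i) → ≈ᴿ-sym (Re z) (Re w) r , ≈ᴿ-sym (Im z) (Im w) i
  ; trans = λ {z} {w} {v} (r , i) (s , j) →
      ≈ᴿ-trans (Re z) (Re w) (Re v) r s , ≈ᴿ-trans (Im z) (Im w) (Im v) i j
  }

open IsEquivalence ≈-isEquivalence using ()
  renaming (refl to ≈-refl; sym to ≈-sym; trans to ≈-trans)

+-cong : ∀ z w u v → z ≈ w → u ≈ v → z + u ≈ w + v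
+-cong z w u v (r , i) (s , j) =
  +ᴿ-cong (Re z) (Re w) (Re u) (Re v) r s , +ᴿ-cong (Im z) (Im w) (Im u) (Im v) i j

*-cong : ∀ z w u v → z ≈ w → u ≈ v → z * u ≈ w * v
*-cong z w u v (r , i) (s , j) =
    +ᴿ-cong (Re z *ᴿ Re u) (Re w *ᴿ Re v) (-ᴿ (Im z *ᴿ Im u)) (-ᴿ (Im w *ᴿ Im v))
      (*ᴿ-cong (Re z) (Re w) (Re u) (Re v) r s)
      (-ᴿ-cong (Im z *ᴿ Im u) (Im w *ᴿ Im v) (*ᴿ-cong (Im z) (Im w) (Im u) (Im v) i j))
  , +ᴿ-cong (Re z *ᴿ Im u) (Re w *ᴿ Im v) (Im z *ᴿ Re u) (Im w *ᴿ Re v)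
      (*ᴿ-cong (Re z) (Re w) (Im u) (Im v) r j)
      (*ᴿ-cong (Im z) (Im w) (Re u) (Re v) i s)

*-assoc : ∀ z w v → (z * w) * v ≈ z * (w * v)
*-assoc z w v = pointwise⇒≈ ((z * w) * v) (z * (w * v))
  (λ n → solve 6 (λ a b c d e f →
      (a :* c :+ :- (b :* d)) :* e :+ :- ((a :* d :+ b :* c) :* f)
        := a :* (c :* e :+ :- (d :* f)) :+ :- (b :* (c :* f :+ d :* e)))
    refl (seq (Re z) n) (seq (Im z) n) (seq (Re w) n) (seq (Im w) n) (seq (Re v) n) (seq (Im v) n))
  (λ n → solve 6 (λ a b c d e f →
      (a :* c :+ :- (b :* d)) :* f :+ (a :* d :+ b :* c) :* e
        := a :* (c :* f :+ d :* e) :+ b :* (c :* e :+ :- (d :* f)))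
    refl (seq (Re z) n) (seq (Im z) n) (seq (Re w) n) (seq (Im w) n) (seq (Re v) n) (seq (Im v) n))

*-comm : ∀ z w → z * w ≈ w * z
*-comm z w = pointwise⇒≈ (z * w) (w * z)
  (λ n → solve 4 (λ a b c d → a :* c :+ :- (b :* d) := c :* a :+ :- (d :* b))
    refl (seq (Re z) n) (seq (Im z) n) (seq (Re w) n) (seq (Im w) n))
  (λ n → solve 4 (λ a b c d → a :* d :+ b :* c := c :* b :+ d :* a)
    refl (seq (Re z) n) (seq (Im z) n) (seq (Re w) n) (seq (Im w) n))

*-identityˡ : ∀ z → 1ℂ * z ≈ z
*-identityˡ z = pointwise⇒≈ (1ℂ * z) z
  (λ n → solve 2 (λ a b → con 1ℚ :* a :+ :- (con 0ℚ :* b) := a) refl (seq (Re z) n) (seq (Im z) n))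
  (λ n → solve 2 (λ a b → con 1ℚ :* b :+ con 0ℚ :* a := b) refl (seq (Re z) n) (seq (Im z) n))

*-distribˡ-+ : ∀ z w v → z * (w + v) ≈ z * w + z * v
*-distribˡ-+ z w v = pointwise⇒≈ (z * (w + v)) (z * w + z * v)
  (λ n → solve 6 (λ a b c d e f →
      a :* (c :+ e) :+ :- (b :* (d :+ f)) := (a :* c :+ :- (b :* d)) :+ (a :* e :+ :- (b :* f)))
    refl (seq (Re z) n) (seq (Im z) n) (seq (Re w) n) (seq (Im w) n) (seq (Re v) n) (seq (Im v) n))
  (λ n → solve 6 (λ a b c d e f →
      a :* (d :+ f) :+ b :* (c :+ e) := (a :* d :+ b :* c) :+ (a :* f :+ b :* e))
    refl (seq (Re z) n) (seq (Im z) n) (seq (Re w) n) (seq (Im w) n) (seq (Re v) n) (seq (Im v) n))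

ℂ-commutativeRing : CommutativeRing 0ℓ 0ℓ
ℂ-commutativeRing = record
  { Carrier = ℂ ; _≈_ = _≈_ ; _+_ = _+_ ; _*_ = _*_ ; -_ = -_ ; 0# = 0ℂ ; 1# = 1ℂ
  ; isCommutativeRing = record
    { isRing = record
      { +-isAbelianGroup = record
        { isGroup = record
          { isMonoid = record
            { isSemigroup = record
              { isMagma = record
                { isEquivalence = ≈-isEquivalence
                ; ∙-cong = λ {z} {w} {u} {v} → +-cong z w u v
                }
              ; assoc = λ z w v → pointwise⇒≈ ((z + w) + v) (z + (w + v))
                  (λ n → ℚ.+-assoc (seq (Re z) n) (seq (Re w) n) (seq (Re v) n))
                  (λ n → ℚ.+-assoc (seq (Im z) n) (seq (Im w) n) (seq (Im v) n))
              }
            ; identity =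
                (λ z → pointwise⇒≈ (0ℂ + z) z
                  (λ n → ℚ.+-identityˡ (seq (Re z) n)) (λ n → ℚ.+-identityˡ (seq (Im z) n)))
              , (λ z → pointwise⇒≈ (z + 0ℂ) z
                  (λ n → ℚ.+-identityʳ (seq (Re z) n)) (λ n → ℚ.+-identityʳ (seq (Im z) n)))
            }
          ; inverse =
              (λ z → pointwise⇒≈ (- z + z) 0ℂ
                (λ n → ℚ.+-inverseˡ (seq (Re z) n)) (λ n → ℚ.+-inverseˡ (seq (Im z) n)))
            , (λ z → pointwise⇒≈ (z + - z) 0ℂ
                (λ n → ℚ.+-inverseʳ (seq (Re z) n)) (λ n → ℚ.+-inverseʳ (seq (Im z) n)))
          ; ⁻¹-cong = λ {z} {w} (r , i) → -ᴿ-cong (Re z) (Re w) r , -ᴿ-cong (Im z) (Im w) i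
          }
        ; comm = λ z w → pointwise⇒≈ (z + w) (w + z)
            (λ n → ℚ.+-comm (seq (Re z) n) (seq (Re w) n))
            (λ n → ℚ.+-comm (seq (Im z) n) (seq (Im w) n))
        }
      ; *-cong = λ {z} {w} {u} {v} → *-cong z w u v
      ; *-assoc = *-assoc
      ; *-identity = *-identityˡ
          , λ z → ≈-trans {z * 1ℂ} {1ℂ * z} {z} (*-comm z 1ℂ) (*-identityˡ z)
      ; distrib = *-distribˡ-+
          , λ z w v → ≈-trans {(w + v) * z} {z * (w + v)} {w * z + v * z} (*-comm (w + v) z)
              (≈-trans {z * (w + v)} {z * w + z * v} {w * z + v * z} (*-distribˡ-+ z w v)
                (+-cong (z * w) (w * z) (z * v) (v * z) (*-comm z w) (*-comm z v)))
      }
    ; *-comm = *-comm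
    }
  }

-- Multiplying z w = 0 by the conjugate of w gives z (c² + d²) = 0 for w = c + i d.
*-cancelʳ-≈0 : ∀ z w → z * w ≈ 0ℂ → ¬ (w ≈ 0ℂ) → z ≈ 0ℂ
*-cancelʳ-≈0 z w (re , im) w≉0 =
    null⇒≈0ᴿ (Re z) (null-cancel {a} {∣w∣²} (cauchy (Re z))
      (null-resp (λ n → solve 4 (λ a b c d →
            c :* (a :* c :- b :* d) :+ d :* (a :* d :+ b :* c) := a :* (c :* c :+ d :* d))
          refl (a n) (b n) (c n) (d n))
        (null-+ {λ n → c n ℚ.* r n} {λ n → d n ℚ.* s n}
          (null-* {c} {r} (cauchy (Re w)) nr) (null-* {d} {s} (cauchy (Im w)) ns)))
      ∣w∣²-not-null)
  , null⇒≈0ᴿ (Im z) (null-cancel {b} {∣w∣²} (cauchy (Im z))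
      (null-resp (λ n → solve 4 (λ a b c d →
            c :* (a :* d :+ b :* c) :+ (:- (d :* (a :* c :- b :* d))) := b :* (c :* c :+ d :* d))
          refl (a n) (b n) (c n) (d n))
        (null-+ {λ n → c n ℚ.* s n} {λ n → ℚ.- (d n ℚ.* r n)}
          (null-* {c} {s} (cauchy (Re w)) ns)
          (null-neg {λ n → d n ℚ.* r n} (null-* {d} {r} (cauchy (Im w)) nr))))
      ∣w∣²-not-null)
  where
  a b c d r s ∣w∣² : ℕ → ℚ
  a = seq (Re z)
  b = seq (Im z)
  c = seq (Re w)
  d = seq (Im w)
  r = seq (Re (z * w))
  s = seq (Im (z * w))
  ∣w∣² n = c n ℚ.* c n ℚ.+ d n ℚ.* d n
  nr : Null r
  nr = ≈0ᴿ⇒null (Re (z * w)) re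
  ns : Null s
  ns = ≈0ᴿ⇒null (Im (z * w)) im
  ∣w∣²-not-null : ¬ Null ∣w∣²
  -- `null-sum-of-squares` controls the first summand, so it is applied once for each order of the
  -- two squares.
  ∣w∣²-not-null null = w≉0
    ( null⇒≈0ᴿ (Re w) (null-sum-of-squares {c} {d} null)
    , null⇒≈0ᴿ (Im w) (null-sum-of-squares {d} {c}
        (null-resp (λ n → ℚ.+-comm (c n ℚ.* c n) (d n ℚ.* d n)) null)))

-- Entries of the incidence matrix at the ends of an edge

principalSqrt-≉0 : ∀ z s → IsPrincipalSqrt z s → ¬ (z ≈ 0ℂ) → ¬ (s ≈ 0ℂ)
principalSqrt-≉0 z s (s*s≈z , _) z≉0 s≈0 =
  z≉0 (≈-trans {z} {s * s} {0ℂ} (≈-sym {s * s} {z} s*s≈z)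
    (≈-trans {s * s} {0ℂ * s} {0ℂ} (*-cong s 0ℂ s s s≈0 (≈-refl {s})) (CommutativeRing.zeroˡ ℂ-commutativeRing s)))

conj-≉0 : ∀ z → ¬ (z ≈ 0ℂ) → ¬ (conj z ≈ 0ℂ)
conj-≉0 z z≉0 (re , im) = z≉0 (re , null⇒≈0ᴿ (Im z)
  (null-resp (λ n → solve 1 (λ x → :- (:- x) := x) refl (seq (Im z) n))
    (null-neg {seq (-ᴿ Im z)} (≈0ᴿ⇒null (-ᴿ Im z) im))))

theorem2p1 : (n : ℕ) → 2 ≤ n →
    (G : OrientedTree n) (E : EdgeListing G) (w : Weighting n) →
    (∀ {u v} → OrientedTree.Arc G u v → ¬ (w u v ≈ 0ℂ)) →
    (∀ {u v} → OrientedTree.Arc G u v → ¬ IsNegativeReal (w u v)) →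
    (N : Matrix ℂ n (n ∸ 1)) → IsSignlessIncidence E w N →
    HasRank N (n ∸ 1)
theorem2p1 n _ G E w w≉0 _ N incidence =
  independent⇒hasRank ℂ-rawRing isRing {n} {n ∸ 1} N
    (coefficients-vanish E ℂ-rawRing isRing N
      ends-regular elsewhere)
  where
  open CommutativeRing ℂ-commutativeRing using (isRing)
  open IsSignlessIncidence incidence
  end≉0 : ∀ {j u v} → Joins E j u v → ¬ (N u j ≈ 0ℂ)
  end≉0 {j} {u} {v} (inj₁ eq) =
    principalSqrt-≉0 (w u v) (N u j) (atTail eq) (w≉0 (edge⇒arc E eq))
  -- Here `u` is the head, so the weight is `w v u` and the entry is a root of its conjugate.
  end≉0 {j} {u} {v} (inj₂ eq) =
    principalSqrt-≉0 (conj (w v u)) (N u j) (atHead eq) (conj-≉0 (w v u) (w≉0 (edge⇒arc E eq)))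
  ends-regular : ∀ {j u v} → Joins E j u v → RightRegular ℂ-rawRing (N u j)
  ends-regular {j} {u} joins z zN≈0 = *-cancelʳ-≈0 z (N u j) zN≈0 (end≉0 joins)
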